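{- For every $\ell\ge 0$, the transpose-free local radix-$b$ FFT of length $b^\ell$, with natural-order constant-size leaves and with twiddle factors evaluated from logical coordinates, has output-layout operator $$\mathcal A_\ell=P_{\pi_\ell}\,\Omega_{b^\ell}.$$ Conversely, the same recursion can consume the digit-reversed input layout and produce a natural-order DFT output: its input-layout operator is $$\mathcal B_\ell=\Omega_{b^\ell}\,P_{\pi_\ell}.$$
   Context: $b=2^t$ is a fixed radix, $[n]=\{0,\dots,n-1\}$, $\omega_n=\exp(2\pi\imath/n)$, and $(\Omega_n)_{k,j}=\omega_n^{ -kj}$ for $k,j\in[n]$. $\pi_\ell:[b^\ell]\to[b^\ell]$ is base-$b$ digit reversal: $\sum_{r=0}^{\ell-1}d_rb^r\mapsto\sum_{r=0}^{\ell-1}d_rb^{\ell-1-r}$. For a permutation $\pi$ of $[n]$, $P_\pi$ is the operator $(P_\pi z)[j]=z[\pi(j)]$ on $\mathbb C^n$. The transpose-free local FFT is the following recursion (a Cooley–Tukey recursion in which the final swap of the two digit fields is never carried out). In output-layout form: $\mathcal A_0$ is the identity on $\mathbb C^1$; $\mathcal A_1=\Omega_b$ (natural-order leaf); for $\ell\ge2$ choose any split $\ell=\ell_1+\ell_2$ with $\ell_1,\ell_2\ge1$ (the choice may differ at every recursive node), put $n_i=b^{\ell_i}$, $n=b^\ell=n_1n_2$, index $\mathbb C^{n}=\mathbb C^{n_1}\otimes\mathbb C^{n_2}$ by the physical coordinate $an_2+c$ with $a\in[n_1],c\in[n_2]$, and set $$\mathcal A_\ell=(I_{n_1}\otimes\mathcal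 A_{\ell_2})\,D\,(\mathcal A_{\ell_1}\otimes I_{n_2}),$$ where $D$ is diagonal with entry $\omega_n^{ -\pi_{\ell_1}(a)\,c}$ at $(a,c)$ (the twiddle uses the logical first-stage frequency $\pi_{\ell_1}(a)$ represented at physical coordinate $a$). In input-layout form the same recursion is executed with both its physical input coordinates and its physical output coordinates interpreted through digit reversal, i.e. $\mathcal B_\ell=P_{\pi_\ell}\mathcal A_\ell P_{\pi_\ell}$. -}

module Defs where

open import Level using (_⊔_) renaming (suc to lsuc)
open import Algebra.Apartness.Bundles using (HeytingField)
open import Algebra.Bundles using (CommutativeRing; Semiring)
import Algebra.Definitions.RawSemiring as RawSemiringDefs
import Algebra.Properties.Ring as RingProperties
import Algebra.Properties.Semiring.Sum as SemiringSum
open import Data.Bool.Base using (if_then_else_)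
open import Data.Fin.Base
  using (Fin; zero; suc; toℕ; cast; remQuot; funToFin; finToFun; opposite)
import Data.Fin.Permutation as Perm
open import Data.Fin.Properties
  using (_≟_; toℕ-injective; toℕ-combine; finToFun-funToFin; opposite-prop; opposite-involutive)
open import Data.Integer.Base as ℤ using (ℤ; +_; -[1+_])
open import Data.Nat.Base as ℕ using (ℕ; zero; suc; NonZero; _∸_)
import Data.Nat.Properties as ℕₚ
open import Data.Product.Base using (_,_; proj₁; proj₂; ∃)
open import Data.Vec.Functional using (Vector)
open import Function.Base using (_∘_)
open import Function.Bundles using (_⇔_; Equivalence)
open import Relation.Binary.PropositionalEquality as ≡ using (_≡_)
open import Relation.Nullary.Decidable using (does)

module FieldOps {c ℓ₁ ℓ₂} (F : HeytingField c ℓ₁ ℓ₂) where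
  open HeytingField F

  commutativeRing : CommutativeRing c ℓ₁
  commutativeRing = record { isCommutativeRing = isCommutativeRing }

  open CommutativeRing commutativeRing public using (semiring; ring)
  open RawSemiringDefs (Semiring.rawSemiring semiring) public using (_×_; _^_)

  infixr 8 _×ᶻ_
  _×ᶻ_ : ℤ → Carrier → Carrier
  (+ n)    ×ᶻ x = n × x
  -[1+ n ] ×ᶻ x = - (suc n × x)

  fromℕ : ℕ → Carrier
  fromℕ n = n × 1#

  -- The library states invertibility for a difference x - y, so this is
  -- literally an inverse of x - 0#.
  inverse : ∀ x → x # 0# → Carrier
  inverse _ x#0 = proj₁ (#⇒invertible x#0)

  zpow : ∀ x → x # 0# → ℤ → Carrier
  zpow x _   (+ n)    = x ^ n
  zpow x x#0 -[1+ n ] = inverse x x#0 ^ suc n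

-- agda-stdlib has no real or complex numbers.  This record collects facts
-- about (ℂ, i, π, exp); ℂ, with x # y meaning 0 < |x - y|, satisfies all of
-- them, so a theorem about an arbitrary `ComplexNumbers` covers ℂ.
-- Nothing is assumed about the roots of unity themselves: ω n below is
-- exp (2πi / n).

record ComplexNumbers c ℓ₁ ℓ₂ : Set (lsuc (c ⊔ ℓ₁ ⊔ ℓ₂)) where
  field
    heytingField : HeytingField c ℓ₁ ℓ₂

  open HeytingField heytingField public
  open FieldOps heytingField public

  field
    fromℕ#0    : ∀ n .{{_ : NonZero n}} → fromℕ n # 0#
    𝕚          : Carrier
    𝕚²≈-1      : 𝕚 * 𝕚 ≈ - 1#
    π          : Carrier

  2π𝕚 : Carrier
  2π𝕚 = fromℕ 2 * π * 𝕚

  field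
    exp        : Carrier → Carrier
    exp-cong   : ∀ {x y} → x ≈ y → exp x ≈ exp y
    exp-+      : ∀ x y → exp (x + y) ≈ exp x * exp y
    exp-kernel : ∀ z → exp z ≈ 1# ⇔ ∃ λ (m : ℤ) → z ≈ m ×ᶻ 2π𝕚

  exp#0 : ∀ z → exp z # 0#
  exp#0 z = invertible⇒# (exp (- z)
      , trans (*-congˡ x-0≈x) (trans (*-comm _ _) inv)
      , trans (*-congʳ x-0≈x) inv)
    where
    exp0≈1 : exp 0# ≈ 1#
    exp0≈1 = Equivalence.from (exp-kernel 0#) (+ 0 , refl)

    inv : exp z * exp (- z) ≈ 1#
    inv = trans (sym (exp-+ z (- z))) (trans (exp-cong (-‿inverseʳ z)) exp0≈1)

    x-0≈x : exp z - 0# ≈ exp z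
    x-0≈x = trans (+-congˡ (RingProperties.-0#≈0# ring)) (+-identityʳ _)

  ω : ∀ n .{{_ : NonZero n}} → Carrier
  ω n = exp (2π𝕚 * inverse (fromℕ n) (fromℕ#0 n))

  ω-pow : ∀ n .{{_ : NonZero n}} → ℤ → Carrier
  ω-pow n = zpow (ω n) (exp#0 _)

-- `finToFun` lists the digits of a number most significant first, and
-- `funToFin` is its inverse.
digitReverse : ∀ b ℓ → Fin (b ℕ.^ ℓ) → Fin (b ℕ.^ ℓ)
digitReverse b ℓ x = funToFin (finToFun {b} {ℓ} x ∘ opposite)

module _ where
  open SemiringSum ℕₚ.+-*-semiring
  open ≡.≡-Reasoning

  toℕ-funToFin : ∀ {b ℓ} (f : Fin ℓ → Fin b) →
    toℕ (funToFin f) ≡ ∑[ r < ℓ ] (toℕ (f r) ℕ.* b ℕ.^ (ℓ ∸ suc (toℕ r)))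
  toℕ-funToFin {ℓ = zero}      f = ≡.refl
  toℕ-funToFin {b} {ℓ = suc ℓ} f = ≡.trans
    (toℕ-combine (f zero) (funToFin (f ∘ suc)))
    (≡.cong₂ ℕ._+_ (ℕₚ.*-comm (b ℕ.^ ℓ) (toℕ (f zero))) (toℕ-funToFin (f ∘ suc)))

  -- `digitReverse` sends ∑ dᵣ bʳ to ∑ dᵣ bˡ⁻¹⁻ʳ.
  digitReverse-spec : ∀ b ℓ (d : Fin ℓ → Fin b) (x : Fin (b ℕ.^ ℓ)) →
    toℕ x ≡ ∑[ r < ℓ ] (toℕ (d r) ℕ.* b ℕ.^ toℕ r) →
    toℕ (digitReverse b ℓ x) ≡ ∑[ r < ℓ ] (toℕ (d r) ℕ.* b ℕ.^ (ℓ ∸ suc (toℕ r)))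
  digitReverse-spec b ℓ d x x≡ = ≡.trans (toℕ-funToFin {b} {ℓ} (finToFun x ∘ opposite))
    (sum-cong-≗ λ r → ≡.cong (λ k → toℕ k ℕ.* b ℕ.^ (ℓ ∸ suc (toℕ r))) (digit r))
    where
    x≡fun : x ≡ funToFin (d ∘ opposite)
    x≡fun = toℕ-injective (begin
      toℕ x
        ≡⟨ x≡ ⟩
      ∑[ r < ℓ ] (toℕ (d r) ℕ.* b ℕ.^ toℕ r)
        ≡⟨ sum-permute (λ r → toℕ (d r) ℕ.* b ℕ.^ toℕ r) Perm.reverse ⟩
      ∑[ r < ℓ ] (toℕ (d (opposite r)) ℕ.* b ℕ.^ toℕ (opposite r))
        ≡⟨ sum-cong-≗ (λ r → ≡.cong (λ k → toℕ (d (opposite r)) ℕ.* b ℕ.^ k) (opposite-prop r)) ⟩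
      ∑[ r < ℓ ] (toℕ (d (opposite r)) ℕ.* b ℕ.^ (ℓ ∸ suc (toℕ r)))
        ≡⟨ toℕ-funToFin {b} {ℓ} (d ∘ opposite) ⟨
      toℕ (funToFin (d ∘ opposite)) ∎)

    digit : ∀ r → finToFun x (opposite r) ≡ d r
    digit r = begin
      finToFun x (opposite r)                         ≡⟨ ≡.cong (λ y → finToFun y (opposite r)) x≡fun ⟩
      finToFun (funToFin (d ∘ opposite)) (opposite r) ≡⟨ finToFun-funToFin (d ∘ opposite) (opposite r) ⟩
      d (opposite (opposite r))                       ≡⟨ ≡.cong d (opposite-involutive r) ⟩
      d r                                             ∎

module Matrices {c ℓ₁ ℓ₂} (ℂ : ComplexNumbers c ℓ₁ ℓ₂) where
  open ComplexNumbers ℂ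
  open SemiringSum semiring using (sum; sum-cong-≋; sum-replicate-zero; sum-syntax)

  -- A linear operator on ℂⁿ is represented by its matrix.
  Matrix : ℕ → Set c
  Matrix n = Fin n → Fin n → Carrier

  infix 4 _≋_
  _≋_ : ∀ {n} → Matrix n → Matrix n → Set ℓ₁
  M ≋ N = ∀ i j → M i j ≈ N i j

  infixl 7 _·_
  _·_ : ∀ {n} → Matrix n → Matrix n → Matrix n
  _·_ {n} M N i j = ∑[ k < n ] (M i k * N k j)

  apply : ∀ {n} → Matrix n → Vector Carrier n → Vector Carrier n
  apply {n} M z i = ∑[ k < n ] (M i k * z k)

  diag : ∀ {n} → (Fin n → Carrier) → Matrix n
  diag d i j = if does (i ≟ j) then d i else 0#

  I : ∀ n → Matrix n
  I n = diag (λ _ → 1#)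

  -- `remQuot n₂` sends a n₂ + c to (a , c).
  infixr 8 _⊗_
  _⊗_ : ∀ {n₁ n₂} → Matrix n₁ → Matrix n₂ → Matrix (n₁ ℕ.* n₂)
  _⊗_ {n₁} {n₂} M N i j =
    let (a , c) = remQuot {n₁} n₂ i ; (a′ , c′) = remQuot {n₁} n₂ j in M a a′ * N c c′

  reindex : ∀ {m n} → .(m ≡ n) → Matrix m → Matrix n
  reindex m≡n M i j = M (cast (≡.sym m≡n) i) (cast (≡.sym m≡n) j)

  -- `P-action` below is the defining property (P z)[j] = z[σ j].
  P : ∀ {n} → (Fin n → Fin n) → Matrix n
  P σ i j = I _ (σ i) j

  P-action : ∀ {n} (σ : Fin n → Fin n) z j → apply (P σ) z j ≈ z (σ j)
  P-action σ z j = sum-δ (σ j) z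
    where
    sum-δ : ∀ {n} (i : Fin n) (z : Vector Carrier n) → sum (λ k → I n i k * z k) ≈ z i
    sum-δ {suc n} zero z = trans
      (+-cong (*-identityˡ _)
        (trans (sum-cong-≋ {n} {y = λ _ → 0#} (λ k → zeroˡ _)) (sum-replicate-zero n)))
      (+-identityʳ _)
    sum-δ (suc i) z = trans (+-cong (zeroˡ _) (sum-δ i (z ∘ suc))) (+-identityˡ _)

  Ω : ∀ n .{{_ : NonZero n}} → Matrix n
  Ω n k j = ω-pow n (ℤ.- (+ (toℕ k ℕ.* toℕ j)))

-- A recursion tree: each node chooses its own split ℓ = ℓ₁ + ℓ₂.
data Plan : ℕ → Set where
  empty : Plan 0
  leaf  : Plan 1
  split : ∀ {ℓ₁ ℓ₂} .{{_ : NonZero ℓ₁}} .{{_ : NonZero ℓ₂}} →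
          Plan ℓ₁ → Plan ℓ₂ → Plan (ℓ₁ ℕ.+ ℓ₂)

module FFT {c ℓ₁ ℓ₂} (ℂ : ComplexNumbers c ℓ₁ ℓ₂) (t : ℕ) where
  open ComplexNumbers ℂ using (Carrier; ω-pow)
  open Matrices ℂ public

  b : ℕ
  b = 2 ℕ.^ t

  N : ℕ → ℕ
  N ℓ = b ℕ.^ ℓ

  N≢0 : ∀ ℓ → NonZero (N ℓ)
  N≢0 ℓ = ℕₚ.m^n≢0 b ℓ {{ℕₚ.m^n≢0 2 t}}

  rev : ∀ ℓ → Fin (N ℓ) → Fin (N ℓ)
  rev = digitReverse b

  twiddle : ∀ ℓ₁ ℓ₂ → Fin (N ℓ₁ ℕ.* N ℓ₂) → Carrier
  twiddle ℓ₁ ℓ₂ i =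
    let (a , c) = remQuot {N ℓ₁} (N ℓ₂) i
    in ω-pow (N (ℓ₁ ℕ.+ ℓ₂)) {{N≢0 (ℓ₁ ℕ.+ ℓ₂)}} (ℤ.- (+ (toℕ (rev ℓ₁ a) ℕ.* toℕ c)))

  -- The leaf is Ω b; the index N 1 = b * 1 is only propositionally equal to b.
  𝒜 : ∀ {ℓ} → Plan ℓ → Matrix (N ℓ)
  𝒜 empty = I 1
  𝒜 leaf  = Ω (N 1) {{N≢0 1}}
  𝒜 (split {ℓ₁} {ℓ₂} p₁ p₂) = reindex (≡.sym (ℕₚ.^-distribˡ-+-* b ℓ₁ ℓ₂))
    ((I (N ℓ₁) ⊗ 𝒜 p₂) · diag (twiddle ℓ₁ ℓ₂) · (𝒜 p₁ ⊗ I (N ℓ₂)))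

  ℬ : ∀ {ℓ} → Plan ℓ → Matrix (N ℓ)
  ℬ {ℓ} p = P (rev ℓ) · 𝒜 p · P (rev ℓ)

  DFT : ∀ ℓ → Matrix (N ℓ)
  DFT ℓ = Ω (N ℓ) {{N≢0 ℓ}}

{-# OPTIONS --safe #-}
module Submission where

-- Write m = b ^ ℓ₁, n = b ^ ℓ₂ and let ρ be digit reversal of the
-- relevant length.  By induction on the plan, the entry of 𝒜 p at (i , j) is
-- ω ^ (- (ρ i * j)), where ω is the root of order b ^ ℓ.  At a split node
-- the two tensor factors with an identity collapse the matrix product to a
-- single term (`⊗-sandwich`): the entry at (a n + c , a′ n + c′) is the product
-- of the second-stage entry at (c , c′), the twiddle at (a , c′) and the
-- first-stage entry at (a , a′), that is
--
--   ω_n ^ (- (ρ c * c′))  *  ω_mn ^ (- (ρ a * c′))  *  ω_m ^ (- (ρ a * a′)).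
--
-- Reversal exchanges the two digit fields, ρ (a n + c) = m ρ c + ρ a
-- (`digitReverse-+`).  Expanding (m ρ c + ρ a) (a′ n + c′) gives the three
-- exponents above, by ω_mn ^ m = ω_n and ω_mn ^ n = ω_m (`ω⁻-scale`), and one
-- multiple of m n, which disappears because ω_mn ^ (m n) = 1 (`ω⁻-period`).
--
-- The input-layout form follows because ρ is an involution:
-- P ρ · 𝒜 p = P ρ · P ρ · Ω = Ω, and it remains to multiply by P ρ on the right.

open import Defs
open import Algebra.Bundles using (CommutativeRing)
import Algebra.Properties.CommutativeSemigroup as CommutativeSemigroupProperties
import Algebra.Properties.CommutativeSemiring.Exp as Exp
import Algebra.Properties.Ring as RingProperties
import Algebra.Properties.Semiring.Mult as Mult
import Algebra.Properties.Semiring.Sum as SemiringSum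
open import Data.Fin.Base
  using (Fin; zero; suc; toℕ; cast; combine; remQuot; funToFin; finToFun; opposite; _↑ˡ_; _↑ʳ_; splitAt)
import Data.Fin.Permutation as Perm
open import Data.Fin.Properties
  using ( _≟_; toℕ-injective; toℕ-combine; toℕ-cast; toℕ-↑ˡ; toℕ-↑ʳ; opposite-prop
        ; opposite-involutive; finToFun-funToFin; funToFin-finToFin
        ; remQuot-combine; combine-remQuot; combine-injective)
open import Data.Integer.Base as ℤ using (+_)
open import Data.Nat.Base as ℕ using (ℕ; zero; suc; NonZero; _∸_)
import Data.Nat.Properties as ℕₚ
open import Data.Nat.Tactic.RingSolver using (solve-∀)
open import Data.Product.Base using (_×_; _,_; proj₁; proj₂)
open import Data.Sum.Base using (inj₁; inj₂)
open import Data.Vec.Functional using (Vector; _++_)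
open import Data.Vec.Functional.Properties using (lookup-++ˡ; lookup-++ʳ)
open import Function.Base using (_∘_)
open import Function.Bundles using (Equivalence)
open import Relation.Binary.PropositionalEquality as ≡ using (_≡_; _≗_)
import Relation.Binary.Reasoning.Setoid as SetoidReasoning
open import Relation.Nullary.Decidable using (yes; no)
open import Relation.Nullary.Negation using (contradiction)

-- Digit reversal

module _ where
  open SemiringSum ℕₚ.+-*-semiring
  open ≡.≡-Reasoning

  funToFin-cong : ∀ {b ℓ} {f g : Fin ℓ → Fin b} → f ≗ g → funToFin f ≡ funToFin g
  funToFin-cong {ℓ = zero}  f≗g = ≡.refl
  funToFin-cong {ℓ = suc ℓ} f≗g = ≡.cong₂ combine (f≗g zero) (funToFin-cong (f≗g ∘ suc))

  digitReverse-involutive : ∀ b ℓ (x : Fin (b ℕ.^ ℓ)) →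
    digitReverse b ℓ (digitReverse b ℓ x) ≡ x
  digitReverse-involutive b ℓ x = begin
    funToFin {ℓ} {b} (finToFun {b} {ℓ} (funToFin (d ∘ opposite)) ∘ opposite)
      ≡⟨ funToFin-cong {b} {ℓ} (λ r → finToFun-funToFin (d ∘ opposite) (opposite r)) ⟩
    funToFin (d ∘ opposite ∘ opposite)
      ≡⟨ funToFin-cong (λ r → ≡.cong d (opposite-involutive r)) ⟩
    funToFin d
      ≡⟨ funToFin-finToFin {ℓ} {b} x ⟩
    x ∎
    where
    d : Fin ℓ → Fin b
    d = finToFun x

  digitReverse-1 : ∀ b (x : Fin (b ℕ.^ 1)) → digitReverse b 1 x ≡ x
  digitReverse-1 b x = ≡.trans
    (funToFin-cong {b} {1} {finToFun x ∘ opposite} {finToFun x} λ { zero → ≡.refl })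
    (funToFin-finToFin {1} {b} x)

  sum-↑ : ∀ m {n} (f : Vector ℕ (m ℕ.+ n)) →
    sum f ≡ sum (f ∘ (_↑ˡ n)) ℕ.+ sum (f ∘ (m ↑ʳ_))
  sum-↑ zero    f = ≡.refl
  sum-↑ (suc m) f = ≡.trans
    (≡.cong (f zero ℕ.+_) (sum-↑ m (f ∘ suc))) (≡.sym (ℕₚ.+-assoc (f zero) _ _))

  -- The number whose digit of weight b ^ r is f r.
  littleEndian : ∀ {b ℓ} → (Fin ℓ → Fin b) → ℕ
  littleEndian {b} {ℓ} f = ∑[ r < ℓ ] (toℕ (f r) ℕ.* b ℕ.^ toℕ r)

  littleEndian-cong : ∀ {b ℓ} {f g : Fin ℓ → Fin b} → f ≗ g → littleEndian f ≡ littleEndian g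
  littleEndian-cong {b} f≗g = sum-cong-≗ λ r → ≡.cong (λ k → toℕ k ℕ.* b ℕ.^ toℕ r) (f≗g r)

  -- Reading the most-significant-first digits of x least significant first
  -- reverses them.
  toℕ-digitReverse : ∀ b ℓ (x : Fin (b ℕ.^ ℓ)) →
    toℕ (digitReverse b ℓ x) ≡ littleEndian (finToFun {b} {ℓ} x)
  toℕ-digitReverse b ℓ x = begin
    toℕ (funToFin (d ∘ opposite))
      ≡⟨ toℕ-funToFin (d ∘ opposite) ⟩
    ∑[ r < ℓ ] (toℕ (d (opposite r)) ℕ.* b ℕ.^ (ℓ ∸ suc (toℕ r)))
      ≡⟨ sum-cong-≗ (λ r → ≡.cong (λ k → toℕ (d (opposite r)) ℕ.* b ℕ.^ k) (opposite-prop r)) ⟨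
    ∑[ r < ℓ ] (toℕ (d (opposite r)) ℕ.* b ℕ.^ toℕ (opposite r))
      ≡⟨ sum-permute (λ r → toℕ (d r) ℕ.* b ℕ.^ toℕ r) Perm.reverse ⟨
    littleEndian d ∎
    where
    d : Fin ℓ → Fin b
    d = finToFun x

  littleEndian-++ : ∀ {b m n} (f : Fin m → Fin b) (g : Fin n → Fin b) →
    littleEndian (f ++ g) ≡ littleEndian f ℕ.+ b ℕ.^ m ℕ.* littleEndian g
  littleEndian-++ {b} {m} {n} f g = ≡.trans (sum-↑ m _) (≡.cong₂ ℕ._+_
    (sum-cong-≗ λ r → ≡.cong₂ (λ k e → toℕ k ℕ.* b ℕ.^ e) (lookup-++ˡ f g r) (toℕ-↑ˡ r n))
    (≡.trans (sum-cong-≗ high) (≡.sym (*-distribˡ-sum (b ℕ.^ m) (λ r → toℕ (g r) ℕ.* b ℕ.^ toℕ r)))))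
    where
    assoc-swap : ∀ k x y → k ℕ.* (x ℕ.* y) ≡ x ℕ.* (k ℕ.* y)
    assoc-swap = solve-∀

    high : ∀ r → toℕ ((f ++ g) (m ↑ʳ r)) ℕ.* b ℕ.^ toℕ (m ↑ʳ r)
               ≡ b ℕ.^ m ℕ.* (toℕ (g r) ℕ.* b ℕ.^ toℕ r)
    high r = begin
      toℕ ((f ++ g) (m ↑ʳ r)) ℕ.* b ℕ.^ toℕ (m ↑ʳ r)
        ≡⟨ ≡.cong₂ (λ k e → toℕ k ℕ.* b ℕ.^ e) (lookup-++ʳ f g r) (toℕ-↑ʳ m r) ⟩
      toℕ (g r) ℕ.* b ℕ.^ (m ℕ.+ toℕ r)
        ≡⟨ ≡.cong (toℕ (g r) ℕ.*_) (ℕₚ.^-distribˡ-+-* b m (toℕ r)) ⟩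
      toℕ (g r) ℕ.* (b ℕ.^ m ℕ.* b ℕ.^ toℕ r)
        ≡⟨ assoc-swap (toℕ (g r)) (b ℕ.^ m) _ ⟩
      b ℕ.^ m ℕ.* (toℕ (g r) ℕ.* b ℕ.^ toℕ r) ∎

  -- Concatenation is the most-significant-first counterpart of
  -- `littleEndian-++`: here it is the first factor that is scaled.
  toℕ-funToFin-++ : ∀ {b m n} (f : Fin m → Fin b) (g : Fin n → Fin b) →
    toℕ (funToFin (f ++ g)) ≡ b ℕ.^ n ℕ.* toℕ (funToFin f) ℕ.+ toℕ (funToFin g)
  toℕ-funToFin-++ {b} {zero} {n} f g =
    ≡.cong (ℕ._+ toℕ (funToFin g)) (≡.sym (ℕₚ.*-zeroʳ (b ℕ.^ n)))
  toℕ-funToFin-++ {b} {suc m} {n} f g = begin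
    toℕ (combine (f zero) (funToFin ((f ++ g) ∘ suc)))
      ≡⟨ toℕ-combine (f zero) _ ⟩
    b ℕ.^ (m ℕ.+ n) ℕ.* toℕ (f zero) ℕ.+ toℕ (funToFin ((f ++ g) ∘ suc))
      ≡⟨ ≡.cong₂ (λ e k → e ℕ.* toℕ (f zero) ℕ.+ k) (ℕₚ.^-distribˡ-+-* b m n)
           (≡.trans (≡.cong toℕ (funToFin-cong (++-suc m f)))
                    (toℕ-funToFin-++ (f ∘ suc) g)) ⟩
    (b ℕ.^ m ℕ.* b ℕ.^ n) ℕ.* toℕ (f zero)
      ℕ.+ (b ℕ.^ n ℕ.* toℕ (funToFin (f ∘ suc)) ℕ.+ toℕ (funToFin g))
      ≡⟨ regroup (b ℕ.^ m) (b ℕ.^ n) (toℕ (f zero)) _ _ ⟩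
    b ℕ.^ n ℕ.* (b ℕ.^ m ℕ.* toℕ (f zero) ℕ.+ toℕ (funToFin (f ∘ suc))) ℕ.+ toℕ (funToFin g)
      ≡⟨ ≡.cong (λ k → b ℕ.^ n ℕ.* k ℕ.+ toℕ (funToFin g)) (toℕ-combine (f zero) _) ⟨
    b ℕ.^ n ℕ.* toℕ (funToFin f) ℕ.+ toℕ (funToFin g) ∎
    where
    regroup : ∀ x y d u v →
      (x ℕ.* y) ℕ.* d ℕ.+ (y ℕ.* u ℕ.+ v) ≡ y ℕ.* (x ℕ.* d ℕ.+ u) ℕ.+ v
    regroup = solve-∀

    ++-suc : ∀ m (f : Fin (suc m) → Fin b) → (f ++ g) ∘ suc ≗ (f ∘ suc) ++ g
    ++-suc m f r with splitAt m r
    ... | inj₁ _ = ≡.refl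
    ... | inj₂ _ = ≡.refl

  digitReverse-+ : ∀ b ℓ₁ ℓ₂ x (a : Fin (b ℕ.^ ℓ₁)) (c : Fin (b ℕ.^ ℓ₂)) →
    toℕ x ≡ b ℕ.^ ℓ₂ ℕ.* toℕ a ℕ.+ toℕ c →
    toℕ (digitReverse b (ℓ₁ ℕ.+ ℓ₂) x)
      ≡ b ℕ.^ ℓ₁ ℕ.* toℕ (digitReverse b ℓ₂ c) ℕ.+ toℕ (digitReverse b ℓ₁ a)
  digitReverse-+ b ℓ₁ ℓ₂ x a c x≡ = begin
    toℕ (digitReverse b (ℓ₁ ℕ.+ ℓ₂) x)
      ≡⟨ toℕ-digitReverse b (ℓ₁ ℕ.+ ℓ₂) x ⟩
    littleEndian (finToFun {b} {ℓ₁ ℕ.+ ℓ₂} x)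
      ≡⟨ littleEndian-cong digits ⟩
    littleEndian (dᵃ ++ dᶜ)
      ≡⟨ littleEndian-++ dᵃ dᶜ ⟩
    littleEndian dᵃ ℕ.+ b ℕ.^ ℓ₁ ℕ.* littleEndian dᶜ
      ≡⟨ ℕₚ.+-comm (littleEndian dᵃ) _ ⟩
    b ℕ.^ ℓ₁ ℕ.* littleEndian dᶜ ℕ.+ littleEndian dᵃ
      ≡⟨ ≡.cong₂ (λ u v → b ℕ.^ ℓ₁ ℕ.* u ℕ.+ v)
           (toℕ-digitReverse b ℓ₂ c) (toℕ-digitReverse b ℓ₁ a) ⟨
    b ℕ.^ ℓ₁ ℕ.* toℕ (digitReverse b ℓ₂ c) ℕ.+ toℕ (digitReverse b ℓ₁ a) ∎
    where
    dᵃ : Fin ℓ₁ → Fin b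
    dᵃ = finToFun a

    dᶜ : Fin ℓ₂ → Fin b
    dᶜ = finToFun c

    x≡fun : x ≡ funToFin (dᵃ ++ dᶜ)
    x≡fun = toℕ-injective (begin
      toℕ x
        ≡⟨ x≡ ⟩
      b ℕ.^ ℓ₂ ℕ.* toℕ a ℕ.+ toℕ c
        ≡⟨ ≡.cong₂ (λ u v → b ℕ.^ ℓ₂ ℕ.* toℕ u ℕ.+ toℕ v)
             (funToFin-finToFin {ℓ₁} {b} a) (funToFin-finToFin {ℓ₂} {b} c) ⟨
      b ℕ.^ ℓ₂ ℕ.* toℕ (funToFin dᵃ) ℕ.+ toℕ (funToFin dᶜ)
        ≡⟨ toℕ-funToFin-++ dᵃ dᶜ ⟨
      toℕ (funToFin (dᵃ ++ dᶜ)) ∎)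

    digits : finToFun {b} {ℓ₁ ℕ.+ ℓ₂} x ≗ dᵃ ++ dᶜ
    digits r = ≡.trans (≡.cong (λ y → finToFun {b} {ℓ₁ ℕ.+ ℓ₂} y r) x≡fun)
                       (finToFun-funToFin (dᵃ ++ dᶜ) r)

-- Roots of unity

module RootsOfUnity {s₁ s₂ s₃} (ℂ : ComplexNumbers s₁ s₂ s₃) where
  open ComplexNumbers ℂ renaming (_×_ to _×ₙ_)
  open CommutativeRing commutativeRing using (commutativeSemiring)
  open Exp commutativeSemiring using (^-homo-*; ^-assocʳ; ^-congˡ; ^-distrib-*)
  open SetoidReasoning setoid

  1^n≈1 : ∀ n → 1# ^ n ≈ 1#
  1^n≈1 zero    = refl
  1^n≈1 (suc n) = trans (*-identityˡ _) (1^n≈1 n)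

  inverseʳ : ∀ x (x#0 : x # 0#) → x * inverse x x#0 ≈ 1#
  inverseʳ x x#0 = trans (*-congʳ (sym x-0≈x)) (proj₂ (proj₂ (#⇒invertible x#0)))
    where
    x-0≈x : x - 0# ≈ x
    x-0≈x = trans (+-congˡ (RingProperties.-0#≈0# ring)) (+-identityʳ _)

  inverse-unique : ∀ x (x#0 : x # 0#) y → x * y ≈ 1# → y ≈ inverse x x#0
  inverse-unique x x#0 y xy≈1 = begin
    y                       ≈⟨ *-identityʳ y ⟨
    y * 1#                  ≈⟨ *-congˡ (inverseʳ x x#0) ⟨
    y * (x * inverse x x#0) ≈⟨ *-assoc _ _ _ ⟨
    y * x * inverse x x#0   ≈⟨ *-congʳ (trans (*-comm y x) xy≈1) ⟩
    1# * inverse x x#0      ≈⟨ *-identityˡ _ ⟩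
    inverse x x#0           ∎

  exp-× : ∀ n z → exp (n ×ₙ z) ≈ exp z ^ n
  exp-× zero    z = Equivalence.from (exp-kernel 0#) (+ 0 , refl)
  exp-× (suc n) z = trans (exp-+ z (n ×ₙ z)) (*-congˡ (exp-× n z))

  ×ₙ-fromℕ : ∀ n x → n ×ₙ x ≈ fromℕ n * x
  ×ₙ-fromℕ n x = sym (trans (Mult.×-assoc-* semiring n 1# x) (Mult.×-congʳ semiring n (*-identityˡ x)))

  fromℕ⁻¹ : ∀ n .{{_ : NonZero n}} → Carrier
  fromℕ⁻¹ n = inverse (fromℕ n) (fromℕ#0 n)

  fromℕ⁻¹-scale : ∀ {k} m {n} .{{_ : NonZero k}} .{{_ : NonZero n}} → k ≡ m ℕ.* n →
    fromℕ m * fromℕ⁻¹ k ≈ fromℕ⁻¹ n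
  fromℕ⁻¹-scale {k} m {n} ≡.refl = inverse-unique _ _ _ (begin
    fromℕ n * (fromℕ m * fromℕ⁻¹ k) ≈⟨ *-assoc _ _ _ ⟨
    fromℕ n * fromℕ m * fromℕ⁻¹ k   ≈⟨ *-congʳ (*-comm _ _) ⟩
    fromℕ m * fromℕ n * fromℕ⁻¹ k   ≈⟨ *-congʳ (Mult.×1-homo-* semiring m n) ⟨
    fromℕ k * fromℕ⁻¹ k             ≈⟨ inverseʳ _ _ ⟩
    1#                              ∎)

  ω^ : ∀ m n .{{_ : NonZero n}} →
    ω n ^ m ≈ exp (2π𝕚 * (fromℕ m * fromℕ⁻¹ n))
  ω^ m n = trans (sym (exp-× m _)) (exp-cong (begin
    m ×ₙ (2π𝕚 * fromℕ⁻¹ n)        ≈⟨ Mult.×-comm-* semiring m _ _ ⟨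
    2π𝕚 * (m ×ₙ fromℕ⁻¹ n)        ≈⟨ *-congˡ (×ₙ-fromℕ m _) ⟩
    2π𝕚 * (fromℕ m * fromℕ⁻¹ n)   ∎))

  ω^-scale : ∀ {k} m {n} .{{_ : NonZero k}} .{{_ : NonZero n}} → k ≡ m ℕ.* n → ω k ^ m ≈ ω n
  ω^-scale {k} m k≡mn = trans (ω^ m k) (exp-cong (*-congˡ (fromℕ⁻¹-scale m k≡mn)))

  ω^n≈1 : ∀ n .{{_ : NonZero n}} → ω n ^ n ≈ 1#
  ω^n≈1 n = trans (ω^ n n) (Equivalence.from (exp-kernel _) (+ 1 , (begin
    2π𝕚 * (fromℕ n * fromℕ⁻¹ n) ≈⟨ *-congˡ (inverseʳ _ _) ⟩
    2π𝕚 * 1#                    ≈⟨ *-identityʳ _ ⟩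
    2π𝕚                         ≈⟨ +-identityʳ _ ⟨
    (+ 1) ×ᶻ 2π𝕚                ∎)))

  -- The conjugate root, the inverse of ω n.
  ω̄ : ∀ n .{{_ : NonZero n}} → Carrier
  ω̄ n = inverse (ω n) (exp#0 _)

  ω^*ω̄^ : ∀ n .{{_ : NonZero n}} m → ω n ^ m * ω̄ n ^ m ≈ 1#
  ω^*ω̄^ n m = begin
    ω n ^ m * ω̄ n ^ m ≈⟨ ^-distrib-* _ _ m ⟨
    (ω n * ω̄ n) ^ m   ≈⟨ ^-congˡ m (inverseʳ _ _) ⟩
    1# ^ m            ≈⟨ 1^n≈1 m ⟩
    1#                ∎

  -- ω_n ^ (- k) for a natural number k: every entry of a DFT matrix and every
  -- twiddle factor is of this form.
  ω⁻ : ∀ n .{{_ : NonZero n}} → ℕ → Carrier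
  ω⁻ n k = ω-pow n (ℤ.- (+ k))

  ω⁻≈ω̄^ : ∀ n .{{_ : NonZero n}} k → ω⁻ n k ≈ ω̄ n ^ k
  ω⁻≈ω̄^ n zero    = refl
  ω⁻≈ω̄^ n (suc k) = refl

  ω⁻-+ : ∀ n .{{_ : NonZero n}} j k → ω⁻ n (j ℕ.+ k) ≈ ω⁻ n j * ω⁻ n k
  ω⁻-+ n j k = begin
    ω⁻ n (j ℕ.+ k)      ≈⟨ ω⁻≈ω̄^ n (j ℕ.+ k) ⟩
    ω̄ n ^ (j ℕ.+ k)     ≈⟨ ^-homo-* _ j k ⟩
    ω̄ n ^ j * ω̄ n ^ k   ≈⟨ *-cong (ω⁻≈ω̄^ n j) (ω⁻≈ω̄^ n k) ⟨
    ω⁻ n j * ω⁻ n k     ∎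

  -- ω̄ k ^ m inverts ω k ^ m, which is ω n, and inverses are unique.
  ω⁻-scale : ∀ {k} m {n} .{{_ : NonZero k}} .{{_ : NonZero n}} → k ≡ m ℕ.* n →
    ∀ x → ω⁻ k (m ℕ.* x) ≈ ω⁻ n x
  ω⁻-scale {k} m {n} k≡mn x = begin
    ω⁻ k (m ℕ.* x)   ≈⟨ ω⁻≈ω̄^ k (m ℕ.* x) ⟩
    ω̄ k ^ (m ℕ.* x)  ≈⟨ ^-assocʳ _ m x ⟨
    (ω̄ k ^ m) ^ x    ≈⟨ ^-congˡ x (inverse-unique _ _ _
                          (trans (*-congʳ (sym (ω^-scale m k≡mn))) (ω^*ω̄^ k m))) ⟩
    ω̄ n ^ x          ≈⟨ ω⁻≈ω̄^ n x ⟨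
    ω⁻ n x           ∎

  ω⁻-period : ∀ n .{{_ : NonZero n}} x → ω⁻ n (n ℕ.* x) ≈ 1#
  ω⁻-period n x = begin
    ω⁻ n (n ℕ.* x)      ≈⟨ ω⁻≈ω̄^ n (n ℕ.* x) ⟩
    ω̄ n ^ (n ℕ.* x)     ≈⟨ ^-assocʳ _ n x ⟨
    (ω̄ n ^ n) ^ x       ≈⟨ ^-congˡ x ω̄^n≈1 ⟩
    1# ^ x              ≈⟨ 1^n≈1 x ⟩
    1#                  ∎
    where
    ω̄^n≈1 : ω̄ n ^ n ≈ 1#
    ω̄^n≈1 = trans (sym (*-identityˡ _)) (trans (*-congʳ (sym (ω^n≈1 n))) (ω^*ω̄^ n n))

  -- The exponent identity of a decimation step, with r₁ and r₂ the logical
  -- frequencies of the two stages and u n + v the input coordinate.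
  ω⁻-split : ∀ {k m n} .{{_ : NonZero k}} .{{_ : NonZero m}} .{{_ : NonZero n}} →
    k ≡ m ℕ.* n → ∀ r₁ r₂ u v →
    ω⁻ n (r₂ ℕ.* v) * ω⁻ k (r₁ ℕ.* v) * ω⁻ m (r₁ ℕ.* u)
      ≈ ω⁻ k ((m ℕ.* r₂ ℕ.+ r₁) ℕ.* (n ℕ.* u ℕ.+ v))
  ω⁻-split {k} {m} {n} k≡mn r₁ r₂ u v = begin
    ω⁻ n (r₂ ℕ.* v) * ω⁻ k (r₁ ℕ.* v) * ω⁻ m (r₁ ℕ.* u)
      ≈⟨ *-cong (*-congʳ (ω⁻-scale m k≡mn _)) (ω⁻-scale n (≡.trans k≡mn (ℕₚ.*-comm m n)) _) ⟨
    ω⁻ k e₂ * ω⁻ k e₁₂ * ω⁻ k e₁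
      ≈⟨ *-congʳ (ω⁻-+ k e₂ e₁₂) ⟨
    ω⁻ k (e₂ ℕ.+ e₁₂) * ω⁻ k e₁
      ≈⟨ ω⁻-+ k (e₂ ℕ.+ e₁₂) e₁ ⟨
    ω⁻ k (e₂ ℕ.+ e₁₂ ℕ.+ e₁)
      ≈⟨ *-identityˡ _ ⟨
    1# * ω⁻ k (e₂ ℕ.+ e₁₂ ℕ.+ e₁)
      ≈⟨ *-congʳ (ω⁻-period k (r₂ ℕ.* u)) ⟨
    ω⁻ k (k ℕ.* (r₂ ℕ.* u)) * ω⁻ k (e₂ ℕ.+ e₁₂ ℕ.+ e₁)
      ≈⟨ ω⁻-+ k (k ℕ.* (r₂ ℕ.* u)) _ ⟨
    ω⁻ k (k ℕ.* (r₂ ℕ.* u) ℕ.+ (e₂ ℕ.+ e₁₂ ℕ.+ e₁))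
      ≡⟨ ≡.cong (ω⁻ k) (≡.trans
           (≡.cong (λ z → z ℕ.* (r₂ ℕ.* u) ℕ.+ (e₂ ℕ.+ e₁₂ ℕ.+ e₁)) k≡mn)
           (expand m n r₁ r₂ u v)) ⟩
    ω⁻ k ((m ℕ.* r₂ ℕ.+ r₁) ℕ.* (n ℕ.* u ℕ.+ v)) ∎
    where
    e₂ e₁₂ e₁ : ℕ
    e₂  = m ℕ.* (r₂ ℕ.* v)
    e₁₂ = r₁ ℕ.* v
    e₁  = n ℕ.* (r₁ ℕ.* u)

    expand : ∀ m n r₁ r₂ u v →
      m ℕ.* n ℕ.* (r₂ ℕ.* u) ℕ.+ (m ℕ.* (r₂ ℕ.* v) ℕ.+ r₁ ℕ.* v ℕ.+ n ℕ.* (r₁ ℕ.* u))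
        ≡ (m ℕ.* r₂ ℕ.+ r₁) ℕ.* (n ℕ.* u ℕ.+ v)
    expand = solve-∀

-- Matrix products with identities, diagonals and permutations

module MatrixProperties {s₁ s₂ s₃} (ℂ : ComplexNumbers s₁ s₂ s₃) where
  open ComplexNumbers ℂ hiding (_×_)
  open Matrices ℂ
  open CommutativeRing commutativeRing using (*-commutativeSemigroup)
  open CommutativeSemigroupProperties *-commutativeSemigroup using (interchange; x∙yz≈y∙xz)
  open SemiringSum semiring using (sum-cong-≋; sum-syntax)
  open SetoidReasoning setoid

  sum-I : ∀ {n} (i : Fin n) (z : Vector Carrier n) → ∑[ k < n ] (I n i k * z k) ≈ z i
  sum-I i z = P-action (λ k → k) z i

  P-· : ∀ {n} (σ : Fin n → Fin n) (M : Matrix n) i j → (P σ · M) i j ≈ M (σ i) j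
  P-· σ M i j = P-action σ (λ k → M k j) i

  I-diag : ∀ {n} (d : Fin n → Carrier) i j → diag d i j ≈ I n i j * d i
  I-diag d i j with i ≟ j
  ... | yes _ = sym (*-identityˡ _)
  ... | no  _ = sym (zeroˡ _)

  I-sym : ∀ {n} (i j : Fin n) → I n i j ≈ I n j i
  I-sym i j with i ≟ j | j ≟ i
  ... | yes _   | yes _   = refl
  ... | no  _   | no  _   = refl
  ... | yes i≡j | no  j≢i = contradiction (≡.sym i≡j) j≢i
  ... | no  i≢j | yes j≡i = contradiction (≡.sym j≡i) i≢j

  ·-diag : ∀ {n} (M : Matrix n) (d : Fin n → Carrier) i j → (M · diag d) i j ≈ M i j * d j
  ·-diag {n} M d i j = trans (sum-cong-≋ {n} term) (sum-I j (λ k → M i k * d k))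
    where
    term : ∀ k → M i k * diag d k j ≈ I n j k * (M i k * d k)
    term k = begin
      M i k * diag d k j      ≈⟨ *-congˡ (trans (I-diag d k j) (*-congʳ (I-sym k j))) ⟩
      M i k * (I n j k * d k) ≈⟨ x∙yz≈y∙xz _ _ _ ⟩
      I n j k * (M i k * d k) ∎

  I-combine : ∀ {m n} (a a′ : Fin m) (c c′ : Fin n) →
    I (m ℕ.* n) (combine a c) (combine a′ c′) ≈ I m a a′ * I n c c′
  I-combine a a′ c c′ with combine a c ≟ combine a′ c′ | a ≟ a′ | c ≟ c′
  ... | yes _  | yes _    | yes _    = sym (*-identityˡ _)
  ... | yes eq | no a≢a′  | _        = contradiction (proj₁ (combine-injective a c a′ c′ eq)) a≢a′
  ... | yes eq | yes _    | no c≢c′  = contradiction (proj₂ (combine-injective a c a′ c′ eq)) c≢c′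
  ... | no ¬eq | yes a≡a′ | yes c≡c′ = contradiction (≡.cong₂ combine a≡a′ c≡c′) ¬eq
  ... | no _   | no _     | _        = sym (zeroˡ _)
  ... | no _   | yes _    | no _     = sym (zeroʳ _)

  -- The two identity factors force the intermediate coordinate to be (a , c′),
  -- leaving one term of the product.
  ⊗-sandwich : ∀ {m n} (M : Matrix m) (M′ : Matrix n) (d : Fin (m ℕ.* n) → Carrier) i j →
    let (a , c) = remQuot {m} n i ; (a′ , c′) = remQuot {m} n j in
    ((I m ⊗ M′) · diag d · (M ⊗ I n)) i j ≈ M′ c c′ * d (combine a c′) * M a a′
  ⊗-sandwich {m} {n} M M′ d i j = begin
    ((I m ⊗ M′) · diag d · (M ⊗ I n)) i j
      ≈⟨ sum-cong-≋ {m ℕ.* n} term ⟩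
    ∑[ k < m ℕ.* n ] (I (m ℕ.* n) (combine a c′) k * z k)
      ≈⟨ sum-I (combine a c′) z ⟩
    z (combine a c′)
      ≡⟨ ≡.cong (λ (x , y) → M′ c y * d (combine a c′) * M x a′) (remQuot-combine a c′) ⟩
    M′ c c′ * d (combine a c′) * M a a′ ∎
    where
    a  = proj₁ (remQuot {m} n i)
    c  = proj₂ (remQuot {m} n i)
    a′ = proj₁ (remQuot {m} n j)
    c′ = proj₂ (remQuot {m} n j)

    z : Fin (m ℕ.* n) → Carrier
    z k = let (x , y) = remQuot {m} n k in M′ c y * d k * M x a′

    term : ∀ k → ((I m ⊗ M′) · diag d) i k * (M ⊗ I n) k j ≈ I (m ℕ.* n) (combine a c′) k * z k
    term k = begin
      ((I m ⊗ M′) · diag d) i k * (M x a′ * I n y c′)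
        ≈⟨ *-cong (trans (·-diag (I m ⊗ M′) d i k) (*-assoc _ _ _)) (*-comm _ _) ⟩
      I m a x * (M′ c y * d k) * (I n y c′ * M x a′)
        ≈⟨ interchange _ _ _ _ ⟩
      I m a x * I n y c′ * z k
        ≈⟨ *-congʳ (*-congˡ (I-sym y c′)) ⟩
      I m a x * I n c′ y * z k
        ≈⟨ *-congʳ (I-combine a x c′ y) ⟨
      I (m ℕ.* n) (combine a c′) (combine x y) * z k
        ≡⟨ ≡.cong (λ l → I (m ℕ.* n) (combine a c′) l * z k) (combine-remQuot {m} n k) ⟩
      I (m ℕ.* n) (combine a c′) k * z k ∎
      where
      x = proj₁ (remQuot {m} n k)
      y = proj₂ (remQuot {m} n k)

-- The transpose-free FFT

module FFTProperties {s₁ s₂ s₃} (ℂ : ComplexNumbers s₁ s₂ s₃) (t : ℕ) where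
  open ComplexNumbers ℂ hiding (_×_)
  open FFT ℂ t
  open RootsOfUnity ℂ
  open MatrixProperties ℂ
  open SemiringSum semiring using (sum-cong-≋)
  open SetoidReasoning setoid

  𝒜-entry : ∀ {ℓ} (p : Plan ℓ) i j → 𝒜 p i j ≈ DFT ℓ (rev ℓ i) j
  𝒜-entry empty zero zero = refl
  𝒜-entry leaf i j = reflexive (≡.cong (λ k → DFT 1 k j) (≡.sym (digitReverse-1 b i)))
  𝒜-entry (split {ℓ₁} {ℓ₂} p₁ p₂) i j = begin
    𝒜 (split p₁ p₂) i j
      ≈⟨ ⊗-sandwich (𝒜 p₁) (𝒜 p₂) (twiddle ℓ₁ ℓ₂) i′ j′ ⟩
    𝒜 p₂ c c′ * twiddle ℓ₁ ℓ₂ (combine a c′) * 𝒜 p₁ a a′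
      ≈⟨ *-cong (*-cong (𝒜-entry p₂ c c′) (reflexive twiddle-combine)) (𝒜-entry p₁ a a′) ⟩
    ω⁻ n (r₂ ℕ.* v) * ω⁻ k (r₁ ℕ.* v) * ω⁻ m (r₁ ℕ.* u)
      ≈⟨ ω⁻-split k≡mn r₁ r₂ u v ⟩
    ω⁻ k ((m ℕ.* r₂ ℕ.+ r₁) ℕ.* (n ℕ.* u ℕ.+ v))
      ≡⟨ ≡.cong₂ (λ x y → ω⁻ k (x ℕ.* y))
           (digitReverse-+ b ℓ₁ ℓ₂ i a c (fields i)) (fields j) ⟨
    DFT (ℓ₁ ℕ.+ ℓ₂) (rev (ℓ₁ ℕ.+ ℓ₂) i) j ∎
    where
    k m n : ℕ
    k = N (ℓ₁ ℕ.+ ℓ₂)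
    m = N ℓ₁
    n = N ℓ₂

    instance
      k≢0 : NonZero k
      k≢0 = N≢0 (ℓ₁ ℕ.+ ℓ₂)
      m≢0 : NonZero m
      m≢0 = N≢0 ℓ₁
      n≢0 : NonZero n
      n≢0 = N≢0 ℓ₂

    k≡mn : k ≡ m ℕ.* n
    k≡mn = ℕₚ.^-distribˡ-+-* b ℓ₁ ℓ₂

    i′ j′ : Fin (m ℕ.* n)
    i′ = cast k≡mn i
    j′ = cast k≡mn j

    a a′ : Fin m
    a  = proj₁ (remQuot {m} n i′)
    a′ = proj₁ (remQuot {m} n j′)

    c c′ : Fin n
    c  = proj₂ (remQuot {m} n i′)
    c′ = proj₂ (remQuot {m} n j′)

    r₁ r₂ u v : ℕ
    r₁ = toℕ (rev ℓ₁ a)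
    r₂ = toℕ (rev ℓ₂ c)
    u  = toℕ a′
    v  = toℕ c′

    twiddle-combine : twiddle ℓ₁ ℓ₂ (combine a c′) ≡ ω⁻ k (r₁ ℕ.* v)
    twiddle-combine =
      ≡.cong (λ (x , y) → ω⁻ k (toℕ (rev ℓ₁ x) ℕ.* toℕ y)) (remQuot-combine a c′)

    fields : ∀ (x : Fin k) → let (q , r) = remQuot {m} n (cast k≡mn x) in
      toℕ x ≡ n ℕ.* toℕ q ℕ.+ toℕ r
    fields x = let (q , r) = remQuot {m} n (cast k≡mn x) in
      ≡.trans (≡.sym (toℕ-cast k≡mn x))
        (≡.trans (≡.cong toℕ (≡.sym (combine-remQuot {m} n (cast k≡mn x)))) (toℕ-combine q r))

  output-layout : ∀ {ℓ} (p : Plan ℓ) → 𝒜 p ≋ P (rev ℓ) · DFT ℓ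
  output-layout {ℓ} p i j = trans (𝒜-entry p i j) (sym (P-· (rev ℓ) (DFT ℓ) i j))

  input-layout : ∀ {ℓ} (p : Plan ℓ) → ℬ p ≋ DFT ℓ · P (rev ℓ)
  input-layout {ℓ} p i j = sum-cong-≋ {N ℓ} λ k → *-congʳ (begin
    (P (rev ℓ) · 𝒜 p) i k       ≈⟨ P-· (rev ℓ) (𝒜 p) i k ⟩
    𝒜 p (rev ℓ i) k             ≈⟨ 𝒜-entry p (rev ℓ i) k ⟩
    DFT ℓ (rev ℓ (rev ℓ i)) k   ≡⟨ ≡.cong (λ x → DFT ℓ x k) (digitReverse-involutive b ℓ i) ⟩
    DFT ℓ i k                   ∎)

lemma2 : ∀ {c ℓ₁ ℓ₂} (ℂ : ComplexNumbers c ℓ₁ ℓ₂) (t ℓ : ℕ) (p : Plan ℓ) →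
    let open FFT ℂ t in
    (𝒜 p ≋ P (rev ℓ) · DFT ℓ) × (ℬ p ≋ DFT ℓ · P (rev ℓ))
lemma2 ℂ t ℓ p = output-layout p , input-layout p
  where open FFTProperties ℂ t
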